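{- For all positive integers $k$ and $\ell$ there exists a positive integer $n$ such that (a) $s(nk)=\ell k$, and (b) $n\le \dfrac{2^{\ell k+n_k}-2^{\mu_2(k)}}{k}$.
   Context: $s(m)$ denotes the sum of the binary digits of the positive integer $m$. For a positive integer $k$, $n_k=\lceil \log_2 k\rceil$ (the smallest nonnegative integer $n$ with $k\le 2^n$), and $\mu_2(k)$ is the exponent of $2$ in $k$, i.e. the largest $\alpha\ge 0$ with $2^\alpha\mid k$. -}

module Defs where

open import Data.Digit using (toDigits)
open import Data.Fin.Base using (toℕ)
open import Data.List.Base using (map; filter; upTo)
open import Data.List.Extrema.Nat using (max)
open import Data.Nat.Base using (ℕ; _^_)
open import Data.Nat.Divisibility using (_∣?_)
open import Data.Nat.ListAction using (sum)
open import Data.Product.Base using (proj₁)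

s : ℕ → ℕ
s m = sum (map toℕ (proj₁ (toDigits 2 m)))

-- For k > 0, 2 ^ α ∣ k forces α < 2 ^ α ≤ k, so searching below k misses no
-- exponent; μ₂ 0 is a junk value.
μ₂ : ℕ → ℕ
μ₂ k = max 0 (filter (λ α → 2 ^ α ∣? k) (upTo k))

{-# OPTIONS --safe #-}

-- If N < 2 ^ (ℓk + n_k) is a multiple of k, both sides are multiples of 2 ^ μ₂ k,
-- which gives the bound in (b).  Doubling a multiple of k / 2 with digit sum
-- 2ℓ(k / 2) settles even k.  For odd k > 1 let h = 2 ^ (n_k ∸ 1) and pick d ≤ k
-- with 2 ^ d ≡ 1 (mod k).  For A < 2 ^ d and N = 2 ^ d (1 + W) - 1 - A, one has
-- s N + s A = d + s W, and k ∣ N as soon as W ≡ A (mod k).  Take W to be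
-- e = ℓk - d ones followed by the n_k digits of B, where s B = s A, so that
-- s N = d + e; it remains to realise one prescribed residue as A - B.  The pairs
-- (2r, r) and (r, 2r) have equal digit sums, and with r < h they give
-- A - B = ± r, hence 2h - 1 = 2 ^ n_k - 1 ≥ k consecutive values.
module Submission where

open import Defs
open import Data.Digit using (Expansion; fromDigits; toDigits)
open import Data.Fin.Base as Fin using (Fin; toℕ)
open import Data.Fin.Properties using (toℕ<n; pigeonhole; toℕ-fromℕ<)
open import Data.Integer.Base using (+_; _-_)
import Data.Integer.Base as ℤ using (_*_; _⊖_; +≤+)
import Data.Integer.Properties as ℤ
open import Data.List.Base using ([]; _∷_; map; upTo)
open import Data.List.Extrema.Nat using (argmax-all)
open import Data.List.Relation.Unary.All.Properties using (all-filter)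
open import Data.Nat.Base using (ℕ; zero; suc; NonZero; ≢-nonZero⁻¹; _+_; _*_; _∸_; _^_; _<_;
  z≤n; s≤s; s≤s⁻¹; z<s; s<s; ⌊_/2⌋; ⌈_/2⌉)
import Data.Nat.Base as ℕ using (_+_; _≤_; _/_)
open import Data.Nat.Coprimality using (Coprime; 1-coprimeTo; coprime-+; coprime-divisor)
open import Data.Nat.Divisibility
open import Data.Nat.DivMod using (DivMod; result; _%_; _divMod_; _mod_; m%n<n; m≡m%n+[m/n]*n)
open import Data.Nat.Induction using (<-rec)
open import Data.Nat.ListAction using (sum)
open import Data.Nat.Logarithm using (⌈log₂_⌉; ⌈log₂⌉-mono-≤;
  ⌈log₂2*n⌉≡1+⌈log₂n⌉; ⌈log₂2^n⌉≡n; ⌈log₂⌈n/2⌉⌉≡⌈log₂n⌉∸1)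
open import Data.Nat.Properties
open import Data.Nat.Tactic.RingSolver using (solve-∀)
open import Data.Product.Base using (∃-syntax; ∃₂; _×_; _,_; proj₁; proj₂)
open import Data.Rational.Base using (_/_; _≤_)
import Data.Rational.Properties as ℚ
import Data.Rational.Unnormalised.Base as ℚᵘ
import Data.Rational.Unnormalised.Properties as ℚᵘ
open import Relation.Binary.PropositionalEquality using (_≡_; _≢_; refl; sym;
  trans; cong; cong₂; subst; module ≡-Reasoning)
open import Relation.Nullary using (contradiction; yes; no)

-- Binary digit sums

m*2≢1+n*2 : ∀ m n → m * 2 ≢ 1 + n * 2
m*2≢1+n*2 m n eq = even≢odd m n (trans (*-comm 2 m) (trans eq (cong suc (*-comm n 2))))

-- `toDigits` is known only through the value of its result, so this lets `s` be read off any
-- expansion. Parity fixes the lowest digit and halving continues; surplus leading zeros add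
-- nothing.
digitSum-unique : ∀ (ds es : Expansion 2) → fromDigits ds ≡ fromDigits es →
                  sum (map toℕ ds) ≡ sum (map toℕ es)
digitSum-unique []                    []                    eq = refl
digitSum-unique []                    (Fin.zero ∷ es)         eq =
  digitSum-unique [] es (*-cancelʳ-≡ 0 (fromDigits es) 2 eq)
digitSum-unique (Fin.zero ∷ ds)         []                    eq =
  digitSum-unique ds [] (*-cancelʳ-≡ (fromDigits ds) 0 2 eq)
digitSum-unique (Fin.zero ∷ ds)         (Fin.zero ∷ es)         eq =
  digitSum-unique ds es (*-cancelʳ-≡ (fromDigits ds) (fromDigits es) 2 eq)
digitSum-unique (Fin.suc Fin.zero ∷ ds) (Fin.suc Fin.zero ∷ es) eq =
  cong suc (digitSum-unique ds es
    (*-cancelʳ-≡ (fromDigits ds) (fromDigits es) 2 (suc-injective eq)))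
digitSum-unique (Fin.zero ∷ ds)         (Fin.suc Fin.zero ∷ es) eq =
  contradiction eq (m*2≢1+n*2 (fromDigits ds) (fromDigits es))
digitSum-unique (Fin.suc Fin.zero ∷ ds) (Fin.zero ∷ es)         eq =
  contradiction (sym eq) (m*2≢1+n*2 (fromDigits es) (fromDigits ds))

s-digit : ∀ (b : Fin 2) m → s (toℕ b + m * 2) ≡ toℕ b + s m
s-digit b m = digitSum-unique (proj₁ (toDigits 2 (toℕ b + m * 2))) (b ∷ proj₁ (toDigits 2 m))
  (trans (proj₂ (toDigits 2 (toℕ b + m * 2)))
         (cong (λ x → toℕ b + x * 2) (sym (proj₂ (toDigits 2 m)))))

s-double : ∀ m → s (m * 2) ≡ s m
s-double = s-digit Fin.zero

-- N is W followed by the bitwise complement of the d lowest digits of A.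
s-complement : ∀ d {N A W} → A < 2 ^ d → N + suc A ≡ 2 ^ d * suc W →
               s N + s A ≡ d + s W
s-complement zero {N} {zero} {W} A<1 eq =
  trans (+-identityʳ (s N)) (cong s (suc-injective (trans (+-comm 1 N) (trans eq (+-identityʳ _)))))
s-complement zero {N} {suc A} (s≤s ()) eq
s-complement (suc d) {N} {A} {W} A<2^[1+d] eq = step (N divMod 2) (A divMod 2) A<2^[1+d] eq
  where
  open ≡-Reasoning
  V = 2 ^ d * suc W
  2^[1+d]*[1+W]≡V*2 : 2 ^ suc d * suc W ≡ V * 2
  2^[1+d]*[1+W]≡V*2 = trans (*-assoc 2 (2 ^ d) (suc W)) (*-comm 2 V)
  halve-< : ∀ a A → a + A * 2 < 2 ^ suc d → A < 2 ^ d
  halve-< a A lt = *-cancelʳ-< 2 A (2 ^ d)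
    (≤-<-trans (m≤n+m _ a) (subst (a + A * 2 <_) (*-comm 2 (2 ^ d)) lt))
  halve-≡ : ∀ N A → 2 + (N + A) * 2 ≡ 2 ^ suc d * suc W → N + suc A ≡ V
  halve-≡ N A eq = trans (+-suc N A)
    (*-cancelʳ-≡ (suc (N + A)) V 2 (trans eq 2^[1+d]*[1+W]≡V*2))
  00-odd : ∀ N A → N * 2 + suc (A * 2) ≡ 1 + (N + A) * 2
  00-odd = solve-∀
  11-odd : ∀ N A → 1 + N * 2 + suc (1 + A * 2) ≡ 1 + suc (N + A) * 2
  11-odd = solve-∀
  01-even : ∀ N A → 2 + (N + A) * 2 ≡ N * 2 + suc (1 + A * 2)
  01-even = solve-∀
  10-even : ∀ N A → 2 + (N + A) * 2 ≡ 1 + N * 2 + suc (A * 2)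
  10-even = solve-∀
  step : ∀ {N A} → DivMod N 2 → DivMod A 2 → A < 2 ^ suc d →
         N + suc A ≡ 2 ^ suc d * suc W → s N + s A ≡ suc d + s W
  -- Equal lowest bits would make `N + suc A` odd, whereas `2 ^ suc d * suc W` is even.
  step (result N Fin.zero refl) (result A Fin.zero refl) lt eq = contradiction
    (trans (sym 2^[1+d]*[1+W]≡V*2) (trans (sym eq) (00-odd N A)))
    (m*2≢1+n*2 V (N + A))
  step (result N (Fin.suc Fin.zero) refl) (result A (Fin.suc Fin.zero) refl) lt eq = contradiction
    (trans (sym 2^[1+d]*[1+W]≡V*2) (trans (sym eq) (11-odd N A)))
    (m*2≢1+n*2 V (suc (N + A)))
  step (result N Fin.zero refl) (result A (Fin.suc Fin.zero) refl) lt eq = begin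
    s (N * 2) + s (1 + A * 2) ≡⟨ cong₂ _+_ (s-double N) (s-digit (Fin.suc Fin.zero) A) ⟩
    s N + suc (s A)           ≡⟨ +-suc (s N) (s A) ⟩
    suc (s N + s A)           ≡⟨ cong suc (s-complement d (halve-< 1 A lt) (halve-≡ N A (trans (01-even N A) eq))) ⟩
    suc d + s W               ∎
  step (result N (Fin.suc Fin.zero) refl) (result A Fin.zero refl) lt eq = begin
    s (1 + N * 2) + s (A * 2) ≡⟨ cong₂ _+_ (s-digit (Fin.suc Fin.zero) N) (s-double A) ⟩
    suc (s N + s A)           ≡⟨ cong suc (s-complement d (halve-< 0 A lt) (halve-≡ N A (trans (10-even N A) eq))) ⟩
    suc d + s W               ∎

suc[2^n∸1]≡2^n : ∀ n → suc (2 ^ n ∸ 1) ≡ 2 ^ n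
suc[2^n∸1]≡2^n n = m+[n∸m]≡n (m^n>0 2 n)

s[2^n∸1]≡n : ∀ n → s (2 ^ n ∸ 1) ≡ n
s[2^n∸1]≡n n = trans (sym (+-identityʳ _)) (trans (s-complement n {A = 0} {W = 0} (m^n>0 2 n)
  (trans (+-comm _ 1) (trans (suc[2^n∸1]≡2^n n) (sym (*-identityʳ _))))) (+-identityʳ n))

-- Both `B + 2 ^ n * M` and `B` have the same `n`-bit complement `B̄` of their low digits.
-- `s-complement` applies to each, with `W` equal to `M` and to 0, and `s B̄` cancels.
s-shift : ∀ n {B} M → B < 2 ^ n → s (B + 2 ^ n * M) ≡ s B + s M
s-shift n {B} M B<2^n = +-cancelʳ-≡ (s B̄) _ _ (begin
  s (B + 2 ^ n * M) + s B̄ ≡⟨ s-complement n B̄<2^n whole ⟩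
  n + s M                  ≡⟨ cong (_+ s M) (trans (s-complement n B̄<2^n low) (+-identityʳ n)) ⟨
  s B + s B̄ + s M         ≡⟨ swap (s B) (s B̄) (s M) ⟩
  s B + s M + s B̄         ∎)
  where
  open ≡-Reasoning
  B̄ = 2 ^ n ∸ suc B
  B+[1+B̄]≡2^n : B + suc B̄ ≡ 2 ^ n
  B+[1+B̄]≡2^n = trans (+-suc B B̄) (m+[n∸m]≡n B<2^n)
  B̄<2^n : B̄ < 2 ^ n
  B̄<2^n = subst (B̄ <_) B+[1+B̄]≡2^n (m≤n+m (suc B̄) B)
  low : B + suc B̄ ≡ 2 ^ n * 1
  low = trans B+[1+B̄]≡2^n (sym (*-identityʳ (2 ^ n)))
  swap : ∀ a b c → a + b + c ≡ a + c + b
  swap = solve-∀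
  whole : B + 2 ^ n * M + suc B̄ ≡ 2 ^ n * suc M
  whole = trans (swap B (2 ^ n * M) (suc B̄))
    (trans (cong (_+ 2 ^ n * M) B+[1+B̄]≡2^n) (sym (*-suc (2 ^ n) M)))

-- Logarithms and powers of two

n≤2^⌈log₂n⌉ : ∀ n → n ℕ.≤ 2 ^ ⌈log₂ n ⌉
n≤2^⌈log₂n⌉ = <-rec (λ n → n ℕ.≤ 2 ^ ⌈log₂ n ⌉) λ
  { 0 _ → z≤n
  ; 1 _ → ≤-refl
  ; n@(suc (suc m)) rec → begin
      n                       ≡⟨ ⌊n/2⌋+⌈n/2⌉≡n n ⟨
      ⌊ n /2⌋ + ⌈ n /2⌉       ≤⟨ +-monoˡ-≤ ⌈ n /2⌉ (⌊n/2⌋≤⌈n/2⌉ n) ⟩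
      ⌈ n /2⌉ + ⌈ n /2⌉       ≡⟨ cong (⌈ n /2⌉ ℕ.+_) (+-identityʳ _) ⟨
      2 * ⌈ n /2⌉             ≤⟨ *-monoʳ-≤ 2 (rec (⌈n/2⌉<n m)) ⟩
      2 * 2 ^ ⌈log₂ ⌈ n /2⌉ ⌉ ≡⟨ cong (λ x → 2 * 2 ^ x) (⌈log₂⌈n/2⌉⌉≡⌈log₂n⌉∸1 n) ⟩
      2 ^ ⌈log₂ n ⌉           ∎
  }
  where open ≤-Reasoning

coprime-odd-2 : ∀ j → Coprime (1 + j * 2) 2
coprime-odd-2 zero    = 1-coprimeTo 2
coprime-odd-2 (suc j) = coprime-+ (coprime-odd-2 j)

odd∣2^i*m⇒∣m : ∀ j i {m} → 1 + j * 2 ∣ 2 ^ i * m → 1 + j * 2 ∣ m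
odd∣2^i*m⇒∣m j zero    {m} div = subst (_ ∣_) (+-identityʳ m) div
odd∣2^i*m⇒∣m j (suc i) {m} div = odd∣2^i*m⇒∣m j i
  (coprime-divisor (coprime-odd-2 j) (subst (1 + j * 2 ∣_) (*-assoc 2 (2 ^ i) m) div))

-- Among the `k + 1` powers with exponents 0 to `k`, two agree modulo `k`; `d` is the difference of
-- their exponents. Their difference is `2 ^ toℕ i * (2 ^ d ∸ 1)`, and the odd `k` must divide the
-- second factor.
∃2^d≡1 : ∀ j → let k = 1 + j * 2 in
         ∃₂ λ d q → 0 < d × d ℕ.≤ k × 2 ^ d ≡ 1 + q * k
∃2^d≡1 j with pigeonhole (n<1+n (1 + j * 2)) (λ i → (2 ^ toℕ i) mod (1 + j * 2))
... | i , i′ , i<i′ , same = d , quotient k∣2^d∸1 , m<n⇒0<n∸m i<i′ ,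
      ≤-trans (m∸n≤m (toℕ i′) (toℕ i)) (s≤s⁻¹ (toℕ<n i′)) ,
      trans (sym (suc[2^n∸1]≡2^n d)) (cong suc (m∣n⇒n≡quotient*m k∣2^d∸1))
  where
  k = 1 + j * 2
  d = toℕ i′ ∸ toℕ i
  P = 2 ^ d ∸ 1
  x y : ℕ
  x = 2 ^ toℕ i
  y = 2 ^ toℕ i′
  x%k≡y%k : x % k ≡ y % k
  x%k≡y%k = trans (sym (toℕ-fromℕ< (m%n<n x k))) (trans (cong toℕ same) (toℕ-fromℕ< (m%n<n y k)))
  x+xP≡y : x + x * P ≡ y
  x+xP≡y = begin
    x + x * P       ≡⟨ *-suc x P ⟨
    x * suc P       ≡⟨ cong (x *_) (suc[2^n∸1]≡2^n d) ⟩
    x * 2 ^ d       ≡⟨ ^-distribˡ-+-* 2 (toℕ i) d ⟨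
    2 ^ (toℕ i + d) ≡⟨ cong (2 ^_) (m+[n∸m]≡n (<⇒≤ i<i′)) ⟩
    y               ∎
    where open ≡-Reasoning
  quotients : (x ℕ./ k) * k + x * P ≡ (y ℕ./ k) * k
  quotients = +-cancelˡ-≡ (x % k) _ _ (begin
    x % k + ((x ℕ./ k) * k + x * P) ≡⟨ +-assoc (x % k) _ _ ⟨
    x % k + (x ℕ./ k) * k + x * P   ≡⟨ cong (_+ x * P) (m≡m%n+[m/n]*n x k) ⟨
    x + x * P                       ≡⟨ x+xP≡y ⟩
    y                               ≡⟨ m≡m%n+[m/n]*n y k ⟩
    y % k + (y ℕ./ k) * k           ≡⟨ cong (_+ (y ℕ./ k) * k) x%k≡y%k ⟨
    x % k + (y ℕ./ k) * k           ∎)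
    where open ≡-Reasoning
  k∣2^d∸1 : k ∣ P
  k∣2^d∸1 = odd∣2^i*m⇒∣m j (toℕ i)
    (∣m+n∣m⇒∣n (divides (y ℕ./ k) quotients) (n∣m*n (x ℕ./ k)))

-- Multiples with prescribed digit sum

multiple-from-pair : ∀ {k d q n e A B u} → 2 ^ d ≡ 1 + q * k →
  A < 2 ^ d → B < 2 ^ n → s A ≡ s B →
  B + 2 ^ n * (2 ^ e ∸ 1) ≡ A + u * k →
  ∃[ m ] (s (m * k) ≡ d + e × m * k < 2 ^ (d + e + n))
multiple-from-pair {k} {d} {q} {n} {e} {A} {B} {u} 2^d≡1+qk A<2^d B<2^n sA≡sB W≡A+uk =
  m , +-cancelʳ-≡ (s A) _ _ sum-eq , bound
  where
  M = 2 ^ e ∸ 1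
  W = B + 2 ^ n * M
  -- From `2 ^ d ≡ 1 + q * k`, the number 2^d (1 + W) - 1 - A equals (W - A) + qk(1 + W), where W -
  -- A = uk.
  m = u + q * suc W
  regroup : ∀ u q w k A → (u + q * w) * k + suc A ≡ suc (A + u * k) + q * k * w
  regroup = solve-∀
  m*k+[1+A]≡2^d*[1+W] : m * k + suc A ≡ 2 ^ d * suc W
  m*k+[1+A]≡2^d*[1+W] = begin
    m * k + suc A                   ≡⟨ regroup u q (suc W) k A ⟩
    suc (A + u * k) + q * k * suc W ≡⟨ cong (λ x → suc x + q * k * suc W) W≡A+uk ⟨
    suc W + q * k * suc W           ≡⟨⟩
    (1 + q * k) * suc W             ≡⟨ cong (_* suc W) 2^d≡1+qk ⟨
    2 ^ d * suc W                   ∎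
    where open ≡-Reasoning
  sum-eq : s (m * k) + s A ≡ d + e + s A
  sum-eq = begin
    s (m * k) + s A ≡⟨ s-complement d A<2^d m*k+[1+A]≡2^d*[1+W] ⟩
    d + s W         ≡⟨ cong (d ℕ.+_) (s-shift n M B<2^n) ⟩
    d + (s B + s M) ≡⟨ cong₂ (λ x y → d + (x + y)) (sym sA≡sB) (s[2^n∸1]≡n e) ⟩
    d + (s A + e)   ≡⟨ cong (d ℕ.+_) (+-comm (s A) e) ⟩
    d + (e + s A)   ≡⟨ +-assoc d e (s A) ⟨
    d + e + s A     ∎
    where open ≡-Reasoning
  bound : m * k < 2 ^ (d + e + n)
  bound = begin
    suc (m * k)                 ≤⟨ m≤m+n _ A ⟩
    suc (m * k) + A             ≡⟨ +-suc (m * k) A ⟨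
    m * k + suc A               ≡⟨ m*k+[1+A]≡2^d*[1+W] ⟩
    2 ^ d * suc W               ≤⟨ *-monoʳ-≤ (2 ^ d) (+-monoˡ-≤ (2 ^ n * M) B<2^n) ⟩
    2 ^ d * (2 ^ n + 2 ^ n * M) ≡⟨ cong (2 ^ d *_) (*-suc (2 ^ n) M) ⟨
    2 ^ d * (2 ^ n * suc M)     ≡⟨ cong (λ x → 2 ^ d * (2 ^ n * x)) (suc[2^n∸1]≡2^n e) ⟩
    2 ^ d * (2 ^ n * 2 ^ e)     ≡⟨ cong (2 ^ d *_) (*-comm (2 ^ n) (2 ^ e)) ⟩
    2 ^ d * (2 ^ e * 2 ^ n)     ≡⟨ *-assoc (2 ^ d) (2 ^ e) (2 ^ n) ⟨
    2 ^ d * 2 ^ e * 2 ^ n       ≡⟨ cong (_* 2 ^ n) (^-distribˡ-+-* 2 d e) ⟨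
    2 ^ (d + e) * 2 ^ n         ≡⟨ ^-distribˡ-+-* 2 (d + e) n ⟨
    2 ^ (d + e + n)             ∎
    where open ≤-Reasoning

-- The two cases realise A - B ≡ c as r and as r - k, where r = c % k.
balanced-pair : ∀ {h k} c .{{_ : NonZero k}} → k < h * 2 →
  ∃[ A ] ∃[ B ] ∃[ u ] (A < h * 2 × B < h * 2 × s A ≡ s B × B + c ≡ A + u * k)
balanced-pair {h} {k} c k<2h with (c % k) <? h
... | yes r<h = r * 2 , r , c ℕ./ k , 2r<2h , ≤-<-trans (m≤m*n r 2) 2r<2h , s-double r ,
      trans (cong (r ℕ.+_) (m≡m%n+[m/n]*n c k)) (regroup r (c ℕ./ k) k)
  where
  r = c % k
  2r<2h = *-monoˡ-< 2 r<h
  regroup : ∀ r u k → r + (r + u * k) ≡ r * 2 + u * k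
  regroup = solve-∀
... | no r≮h = t , t * 2 , 1 + c ℕ./ k , ≤-<-trans (m≤m*n t 2) 2t<2h , 2t<2h , sym (s-double t) ,
      (begin
        t * 2 + c                     ≡⟨ cong (t * 2 ℕ.+_) (m≡m%n+[m/n]*n c k) ⟩
        t * 2 + (r + (c ℕ./ k) * k)   ≡⟨ regroup t r ((c ℕ./ k) * k) ⟩
        t + ((r + t) + (c ℕ./ k) * k) ≡⟨ cong (λ x → t + (x + (c ℕ./ k) * k)) r+t≡k ⟩
        t + (k + (c ℕ./ k) * k)       ∎)
  where
  open ≡-Reasoning
  r = c % k
  t = k ∸ r
  r+t≡k : r + t ≡ k
  r+t≡k = m+[n∸m]≡n (<⇒≤ (m%n<n c k))
  -- Since `h ≤ r`, the sum `h + t` is at most `r + t ≡ k`, which is below 2h; hence `t < h` and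
  -- `t * 2` still fits.
  h+t<h+h : h + t < h + h
  h+t<h+h = ≤-<-trans (+-monoˡ-≤ t (≮⇒≥ r≮h))
    (subst (_< h + h) (sym r+t≡k) (subst (k <_) (trans (*-comm h 2) (cong (h ℕ.+_) (+-identityʳ h))) k<2h))
  2t<2h : t * 2 < h * 2
  2t<2h = *-monoˡ-< 2 (+-cancelˡ-< h t h h+t<h+h)
  regroup : ∀ t r v → t * 2 + (r + v) ≡ t + ((r + t) + v)
  regroup = solve-∀

-- This form suits the recursion: both sides of the strict bound double exactly when `k` does.
-- Positivity of `m` and the term `2 ^ μ₂ k` are recovered at the end.
HasMultiple : ℕ → ℕ → Set
HasMultiple k ℓ = ∃[ m ] (s (m * k) ≡ ℓ * k × m * k < 2 ^ (ℓ * k + ⌈log₂ k ⌉))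

hasMultiple-1 : ∀ ℓ → HasMultiple 1 ℓ
hasMultiple-1 ℓ = M , trans (cong s (*-identityʳ M)) (trans (s[2^n∸1]≡n ℓ) (sym (*-identityʳ ℓ))) ,
  ≤-reflexive (trans (cong suc (*-identityʳ M)) (trans (suc[2^n∸1]≡2^n ℓ)
    (cong (2 ^_) (sym (trans (+-identityʳ (ℓ * 1)) (*-identityʳ ℓ))))))
  where M = 2 ^ ℓ ∸ 1

hasMultiple-double : ∀ j ℓ .{{_ : NonZero j}} → HasMultiple j (ℓ * 2) → HasMultiple (j * 2) ℓ
hasMultiple-double j ℓ (m , sum-eq , bound) = m , (begin
    s (m * (j * 2)) ≡⟨ cong s (*-assoc m j 2) ⟨
    s (m * j * 2)   ≡⟨ s-double (m * j) ⟩
    s (m * j)       ≡⟨ sum-eq ⟩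
    ℓ * 2 * j       ≡⟨ ℓ2j ⟩
    ℓ * (j * 2)     ∎) ,
  subst (_< 2 ^ (ℓ * (j * 2) + ⌈log₂ (j * 2) ⌉)) (*-assoc m j 2)
    (subst (m * j * 2 <_) rhs (*-monoˡ-< 2 bound))
  where
  open ≡-Reasoning
  ℓ2j : ℓ * 2 * j ≡ ℓ * (j * 2)
  ℓ2j = trans (*-assoc ℓ 2 j) (cong (ℓ *_) (*-comm 2 j))
  rhs : 2 ^ (ℓ * 2 * j + ⌈log₂ j ⌉) * 2 ≡ 2 ^ (ℓ * (j * 2) + ⌈log₂ (j * 2) ⌉)
  rhs = begin
    2 ^ (ℓ * 2 * j + ⌈log₂ j ⌉) * 2     ≡⟨ *-comm (2 ^ (ℓ * 2 * j + ⌈log₂ j ⌉)) 2 ⟩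
    2 ^ suc (ℓ * 2 * j + ⌈log₂ j ⌉)     ≡⟨ cong (2 ^_) (+-suc (ℓ * 2 * j) ⌈log₂ j ⌉) ⟨
    2 ^ (ℓ * 2 * j + suc ⌈log₂ j ⌉)     ≡⟨ cong (λ x → 2 ^ (ℓ * 2 * j + x)) (⌈log₂2*n⌉≡1+⌈log₂n⌉ j) ⟨
    2 ^ (ℓ * 2 * j + ⌈log₂ (2 * j) ⌉)   ≡⟨ cong₂ (λ x y → 2 ^ (x + ⌈log₂ y ⌉)) ℓ2j (*-comm 2 j) ⟩
    2 ^ (ℓ * (j * 2) + ⌈log₂ (j * 2) ⌉) ∎

-- Stated with h = 2 ^ (n_k ∸ 1) to expose that n_k ≠ 0.
odd<2^⌈log₂⌉ : ∀ j .{{_ : NonZero j}} → let k = 1 + j * 2 in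
               ∃[ h ] (2 ^ ⌈log₂ k ⌉ ≡ h * 2 × k < h * 2)
odd<2^⌈log₂⌉ j@(suc i) = h , *-comm 2 h ,
  ≤∧≢⇒< (subst (k ℕ.≤_) (*-comm 2 h) (n≤2^⌈log₂n⌉ k)) (λ eq → m*2≢1+n*2 h j (sym eq))
  where
  k = 1 + j * 2
  h = 2 ^ (⌈log₂ k ⌉ ∸ 1)

-- `q` cannot be 0, as a positive power of two is not 1. Taking logarithms then gives n_k ≤ d, so an
-- `A` of n_k digits fits in `d` digits.
k≤2^d : ∀ {k d q} → 0 < d → 2 ^ d ≡ 1 + q * k → k ℕ.≤ 2 ^ d
k≤2^d {k} {suc d} {zero}  _ eq = contradiction (trans (*-comm (2 ^ d) 2) eq) (m*2≢1+n*2 (2 ^ d) 0)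
k≤2^d {k} {d}     {suc q} _ eq =
  subst (k ℕ.≤_) (sym eq) (≤-trans (m≤n*m k (suc q)) (n≤1+n (suc q * k)))

multiple-from-period : ∀ {k d q n h} e .{{_ : NonZero k}} →
  2 ^ d ≡ 1 + q * k → n ℕ.≤ d → 2 ^ n ≡ h * 2 → k < h * 2 →
  ∃[ m ] (s (m * k) ≡ d + e × m * k < 2 ^ (d + e + n))
multiple-from-period {k} {d} {q} {n} {h} e 2^d≡1+qk n≤d 2^n≡2h k<2h =
  -- The prescribed residue is that of the block of `e` ones above the `n` digits of `B`, so that
  -- `W` becomes congruent to `A`.
  let A , B , u , A<2h , B<2h , sA≡sB , W≡A+uk = balanced-pair {h} (2 ^ n * (2 ^ e ∸ 1)) k<2h
  in multiple-from-pair {d = d} {q} {n} {e} {u = u} 2^d≡1+qk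
       (<-≤-trans (subst (A <_) (sym 2^n≡2h) A<2h) (^-monoʳ-≤ 2 n≤d))
       (subst (B <_) (sym 2^n≡2h) B<2h) sA≡sB W≡A+uk

hasMultiple-odd : ∀ j ℓ .{{_ : NonZero j}} .{{_ : NonZero ℓ}} → HasMultiple (1 + j * 2) ℓ
hasMultiple-odd j@(suc _) ℓ =
  let k = 1 + j * 2
      n = ⌈log₂ k ⌉
      h , 2^n≡2h , k<2h = odd<2^⌈log₂⌉ j
      d , q , 0<d , d≤k , 2^d≡1+qk = ∃2^d≡1 j
      n≤d = subst (n ℕ.≤_) (⌈log₂2^n⌉≡n d)
              (⌈log₂⌉-mono-≤ (k≤2^d {k} {d} {q} 0<d 2^d≡1+qk))
  in subst (λ x → ∃[ m ] (s (m * k) ≡ x × m * k < 2 ^ (x + n)))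
       -- As `d ≤ k ≤ ℓ * k`, the truncated difference `ℓ * k ∸ d` is exact.
       (m+[n∸m]≡n (≤-trans d≤k (m≤n*m k ℓ)))
       (multiple-from-period {k} {d} {q} {n} {h} (ℓ * k ∸ d) 2^d≡1+qk n≤d 2^n≡2h k<2h)

hasMultiple : ∀ k ℓ .{{_ : NonZero k}} .{{_ : NonZero ℓ}} → HasMultiple k ℓ
hasMultiple = <-rec P λ k rec ℓ → step k (k divMod 2) rec ℓ
  where
  P : ℕ → Set
  -- `ℓ` varies inside the induction, because the even case calls the hypothesis at `ℓ * 2`.
  P k = ∀ ℓ .{{_ : NonZero k}} .{{_ : NonZero ℓ}} → HasMultiple k ℓ
  step : ∀ k → DivMod k 2 → (∀ {j} → j < k → P j) → P k
  step _ (result zero      (Fin.suc Fin.zero) refl) rec ℓ = hasMultiple-1 ℓ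
  step _ (result j@(suc _) (Fin.suc Fin.zero) refl) rec ℓ = hasMultiple-odd j ℓ
  step _ (result j@(suc _) Fin.zero           refl) rec ℓ =
    hasMultiple-double j ℓ (rec (m<m*n j 2 (s<s z<s)) (ℓ * 2) {{_}} {{m*n≢0 ℓ 2}})

-- Powers of two dividing k

-- The filter guarantees this for every candidate exponent, and the default 0 of `max` gives the
-- divisor 1.
2^μ₂∣ : ∀ k → 2 ^ μ₂ k ∣ k
2^μ₂∣ k = argmax-all (λ α → α) {P = λ α → 2 ^ α ∣ k} (1∣ k) (all-filter (λ α → 2 ^ α ∣? k) (upTo k))

2^m≤2^n⇒2^m∣2^n : ∀ m n → 2 ^ m ℕ.≤ 2 ^ n → 2 ^ m ∣ 2 ^ n
2^m≤2^n⇒2^m∣2^n m n le = subst (2 ^ m ∣_)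
  (trans (sym (^-distribˡ-+-* 2 m (n ∸ m))) (cong (2 ^_) (m+[n∸m]≡n m≤n)))
  (m∣m*n (2 ^ (n ∸ m)))
  where
  m≤n : m ℕ.≤ n
  m≤n = ≮⇒≥ (λ n<m → <⇒≱ (^-monoʳ-< 2 (s<s z<s) n<m) le)

-- The quotients by `g` differ by at least 1. This turns the strict bound into one with `2 ^ μ₂ k`
-- to spare.
∣∧<⇒+≤ : ∀ {g a b} → g ∣ a → g ∣ b → a < b → a + g ℕ.≤ b
∣∧<⇒+≤ {g} (divides-refl p) (divides-refl q) a<b =
  subst (ℕ._≤ q * g) (+-comm g (p * g)) (*-monoˡ-≤ g (*-cancelʳ-< g p q a<b))

-- In unnormalised rationals the order is plain cross-multiplication, without reduction to lowest
-- terms. The hypothesis forces `b ≤ a`, so `a ∸ b` agrees with the integer difference.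
/1≤/ : ∀ n k a b .{{_ : NonZero k}} → n * k + b ℕ.≤ a → (+ n / 1) ≤ ((+ a - + b) / k)
/1≤/ n k@(suc k-1) a b le = ℚ.toℚᵘ-cancel-≤
  (ℚᵘ.≤-respˡ-≃ (ℚᵘ.≃-sym (ℚ.toℚᵘ-fromℚᵘ (ℚᵘ.mkℚᵘ (+ n) 0)))
    (ℚᵘ.≤-respʳ-≃ (ℚᵘ.≃-sym (ℚ.toℚᵘ-fromℚᵘ (ℚᵘ.mkℚᵘ (+ a - + b) k-1)))
      (ℚᵘ.*≤* (begin
        + n ℤ.* + k         ≡⟨ ℤ.pos-* n k ⟨
        + (n * k)           ≤⟨ ℤ.+≤+ (m+n≤o⇒m≤o∸n (n * k) le) ⟩
        + (a ∸ b)           ≡⟨ ℤ.⊖-≥ (m+n≤o⇒n≤o (n * k) le) ⟨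
        a ℤ.⊖ b             ≡⟨ ℤ.m-n≡m⊖n a b ⟨
        + a - + b           ≡⟨ ℤ.*-identityʳ (+ a - + b) ⟨
        (+ a - + b) ℤ.* + 1 ∎))))
  where open ℤ.≤-Reasoning

mainTheorem2 : ∀ (k ℓ : ℕ) .{{_ : NonZero k}} .{{_ : NonZero ℓ}} →
    ∃[ n ] (0 < n
    × s (n * k) ≡ ℓ * k
    × (+ n / 1) ≤ ((+ (2 ^ (ℓ * k + ⌈log₂ k ⌉)) - + (2 ^ μ₂ k)) / k))
mainTheorem2 k ℓ with hasMultiple k ℓ
... | n , sum-eq , bound = n , n>0 n sum-eq , sum-eq ,
  /1≤/ n k (2 ^ L) (2 ^ μ₂ k) (∣∧<⇒+≤ (∣n⇒∣m*n n (2^μ₂∣ k)) (2^m≤2^n⇒2^m∣2^n (μ₂ k) L 2^μ≤2^L) bound)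
  where
  L = ℓ * k + ⌈log₂ k ⌉
  n>0 : ∀ n → s (n * k) ≡ ℓ * k → 0 < n
  -- The digit sum of 0 is 0, but `ℓ * k` is nonzero.
  n>0 zero    eq = contradiction (sym eq) (≢-nonZero⁻¹ (ℓ * k) {{m*n≢0 ℓ k}})
  n>0 (suc _) eq = z<s
  2^μ≤2^L : 2 ^ μ₂ k ℕ.≤ 2 ^ L
  2^μ≤2^L = ≤-trans (∣⇒≤ (2^μ₂∣ k))
    (≤-trans (n≤2^⌈log₂n⌉ k) (^-monoʳ-≤ 2 (m≤n+m ⌈log₂ k ⌉ (ℓ * k))))
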